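{- For every positive integer $n$, the number of ordered set partitions of $[n]$ into exactly $3$ blocks that avoid the pattern $132$ is $$\operatorname{op}_{n,3}(132) = \left(\frac{n^2}{8}+\frac{3n}{8}-2\right)2^n+3.$$
   Context: An ordered set partition of $[n]$ into $k$ blocks is a sequence $B_1/B_2/\cdots/B_k$ of nonempty, pairwise disjoint subsets of $[n]$ whose union is $[n]$; the order of the blocks matters, but not the order of elements within a block. For a permutation $\rho=\rho_1\cdots\rho_m\in\mathcal{S}_m$, an ordered partition $B_1/\cdots/B_k$ contains $\rho$ if there are block indices $i_1<i_2<\cdots<i_m$ and elements $b_j\in B_{i_j}$ such that $b_1\cdots b_m$ is order-isomorphic to $\rho$ (i.e. $b_a<b_c$ iff $\rho_a<\rho_c$); otherwise it avoids $\rho$. $\operatorname{op}_{n,k}(\rho)$ denotes the number of ordered partitions of $[n]$ into $k$ blocks that avoid $\rho$. -}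

module Defs where

open import Data.Bool using (true; false)
open import Data.Fin using (Fin; _<_; #_)
open import Data.Fin.Permutation using (Permutation′; _⟨$⟩ʳ_; transpose)
open import Data.Fin.Properties using (any?; all?; _≟_; _<?_)
open import Data.Fin.Subset using (Subset; _∈_; _∩_; Nonempty; Empty)
open import Data.Fin.Subset.Properties using (_∈?_; nonempty?)
open import Data.List using (List; []; _∷_; allFin; cartesianProductWith; filter; length)
import Data.List.Membership.Propositional as List
open import Data.List.Membership.Propositional using (find; lose)
open import Data.List.Membership.Propositional.Properties using (∈-allFin; ∈-cartesianProductWith⁺)
import Data.List.Relation.Unary.All as All
import Data.List.Relation.Unary.Any as Any
open import Data.List.Relation.Unary.AllPairs using ([]; _∷_)
open import Data.List.Relation.Unary.Any using (here; there)
open import Data.List.Relation.Unary.Unique.Propositional using (Unique)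
import Data.List.Relation.Unary.Unique.Propositional.Properties as Unique
open import Data.Nat using (ℕ; zero; suc)
open import Data.Product using (∃; _×_; _,_)
open import Data.Vec using (Vec; []; _∷_; lookup)
open import Data.Vec.Properties using (∷-injective)
open import Function.Bundles using (_⇔_; mk⇔; Equivalence)
open import Relation.Binary.PropositionalEquality using (_≢_; refl)
open import Relation.Nullary using (Dec; ¬_; ¬?)
open import Relation.Nullary.Decidable using (map′; _×-dec_; _→-dec_)
open import Relation.Unary using (Decidable)

private
  variable
    A : Set
    k m n : ℕ

-- The ground set [n] = {1, …, n} is represented by Fin n, with 1, …, n
-- shifted to 0, …, n - 1; only the order of the elements matters.

record IsOrderedPartition {n k : ℕ} (B : Vec (Subset n) k) : Set where
  constructor isOrderedPartition
  field
    nonempty : ∀ i → Nonempty (lookup B i)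
    disjoint : ∀ i j → i ≢ j → Empty (lookup B i ∩ lookup B j)
    covers   : ∀ x → ∃ λ i → x ∈ lookup B i

StrictlyIncreasing : Vec (Fin k) m → Set
StrictlyIncreasing is = ∀ a c → a < c → lookup is a < lookup is c

OrderIsomorphic : Vec (Fin n) m → Permutation′ m → Set
OrderIsomorphic bs ρ =
  ∀ a c → (lookup bs a < lookup bs c) ⇔ (ρ ⟨$⟩ʳ a < ρ ⟨$⟩ʳ c)

-- The one-line notation ρ₁⋯ρₘ of ρ has ρ ⟨$⟩ʳ j as its j-th letter.
Contains : Vec (Subset n) k → Permutation′ m → Set
Contains {n} {k} {m} B ρ =
  ∃ λ (is : Vec (Fin k) m) → StrictlyIncreasing is ×
  ∃ λ (bs : Vec (Fin n) m) → (∀ j → lookup bs j ∈ lookup B (lookup is j)) ×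
  OrderIsomorphic bs ρ

Avoids : Vec (Subset n) k → Permutation′ m → Set
Avoids B ρ = ¬ Contains B ρ

vectors : List A → ∀ m → List (Vec A m)
vectors xs zero    = [] ∷ []
vectors xs (suc m) = cartesianProductWith _∷_ xs (vectors xs m)

vectors-complete : {xs : List A} → (∀ x → x List.∈ xs) →
                   (v : Vec A m) → v List.∈ vectors xs m
vectors-complete all []      = here refl
vectors-complete all (x ∷ v) =
  ∈-cartesianProductWith⁺ _∷_ (all x) (vectors-complete all v)

vectors-unique : {xs : List A} → Unique xs → ∀ m → Unique (vectors xs m)
vectors-unique u zero    = All.[] ∷ []
vectors-unique u (suc m) =
  Unique.cartesianProductWith⁺ _∷_ ∷-injective u (vectors-unique u m)

subsets : ∀ n → List (Subset n)
subsets = vectors (true ∷ false ∷ [])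

subsets-complete : (p : Subset n) → p List.∈ subsets n
subsets-complete = vectors-complete λ where
  true  → here refl
  false → there (here refl)

subsets-unique : ∀ n → Unique (subsets n)
subsets-unique = vectors-unique (((λ ()) All.∷ All.[]) ∷ All.[] ∷ [])

blockSequences : ∀ n k → List (Vec (Subset n) k)
blockSequences n = vectors (subsets n)

blockSequences-complete : (B : Vec (Subset n) k) → B List.∈ blockSequences n k
blockSequences-complete = vectors-complete subsets-complete

blockSequences-unique : ∀ n k → Unique (blockSequences n k)
blockSequences-unique n = vectors-unique (subsets-unique n)

anyVec? : {P : Vec (Fin k) m → Set} → Decidable P → Dec (∃ P)
anyVec? {k} {m} P? = map′
  (λ p → let v , _ , pv = find p in v , pv)
  (λ (v , pv) → lose (vectors-complete ∈-allFin v) pv)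
  (Any.any? P? (vectors (allFin k) m))

isOrderedPartition? : Decidable (IsOrderedPartition {n} {k})
isOrderedPartition? B = map′
  (λ (ne , dj , cv) → isOrderedPartition ne dj cv)
  (λ (isOrderedPartition ne dj cv) → ne , dj , cv)
  (all? (λ i → nonempty? (lookup B i))
    ×-dec all? (λ i → all? λ j →
            ¬? (i ≟ j) →-dec ¬? (nonempty? (lookup B i ∩ lookup B j)))
    ×-dec all? (λ x → any? λ i → x ∈? lookup B i))

strictlyIncreasing? : Decidable (StrictlyIncreasing {k} {m})
strictlyIncreasing? is =
  all? λ a → all? λ c → (a <? c) →-dec (lookup is a <? lookup is c)

orderIsomorphic? : (bs : Vec (Fin n) m) (ρ : Permutation′ m) →
                   Dec (OrderIsomorphic bs ρ)
orderIsomorphic? bs ρ = all? λ a → all? λ c →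
  let p? = lookup bs a <? lookup bs c
      q? = (ρ ⟨$⟩ʳ a) <? (ρ ⟨$⟩ʳ c)
  in map′ (λ (f , g) → mk⇔ f g)
          (λ e → Equivalence.to e , Equivalence.from e)
          ((p? →-dec q?) ×-dec (q? →-dec p?))

contains? : (B : Vec (Subset n) k) (ρ : Permutation′ m) → Dec (Contains B ρ)
contains? B ρ =
  anyVec? λ is → strictlyIncreasing? is ×-dec
  anyVec? λ bs → all? (λ j → lookup bs j ∈? lookup B (lookup is j)) ×-dec
  orderIsomorphic? bs ρ

avoids? : (B : Vec (Subset n) k) (ρ : Permutation′ m) → Dec (Avoids B ρ)
avoids? B ρ = ¬? (contains? B ρ)

-- A genuine count: blockSequences n k lists every k-tuple of subsets of [n]
-- exactly once (blockSequences-complete, blockSequences-unique).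
op : ∀ n k → Permutation′ m → ℕ
op n k ρ =
  length (filter (λ B → isOrderedPartition? B ×-dec avoids? B ρ)
                 (blockSequences n k))

-- 132 in one-line notation: on {0, 1, 2} it sends 0 ↦ 0, 1 ↦ 2, 2 ↦ 1.
pattern132 : Permutation′ 3
pattern132 = transpose (# 1) (# 2)

{-# OPTIONS --safe #-}
-- Encode an ordered partition of [n] into three blocks by the word over {0, 1, 2}
-- whose x-th letter is the index of the block of x.  It avoids 132 exactly when
-- the word has no subsequence 0, 2, 1 (an occurrence b₁ < b₃ < b₂ read by increasing
-- value).  Reading a word from the left, it suffices to remember the part p of the
-- forbidden subsequence not yet matched greedily and the set m of letters still to
-- be used, which gives a linear recursion between the counts of the states (p , m).
module Submission where

open import Defs
open import Data.Integer using (+_)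
open import Data.Nat as ℕ using (ℕ)
open import Data.Rational using (_/_; _+_; _-_; _*_)
open import Relation.Binary.PropositionalEquality using (_≡_)

open import Data.Bool using (true; false; if_then_else_)
open import Data.Fin using (Fin; toℕ; #_) renaming (zero to fzero; suc to fsuc; _<_ to _<ᶠ_)
open import Data.Fin.Properties using (any?; all?; _≟_; _<?_; <-trans; <-asym; <-irrefl)
open import Data.Fin.Subset using (Subset; _∈_; _∉_; ⊤; ⊥; ⁅_⁆; _∪_) renaming (_-_ to _∖_)
open import Data.Fin.Subset.Properties using (_∈?_; ∈⊤; p─q⊆p; x∈p∧x≢y⇒x∈p-y; x∈p∩q⁺; x∈p∩q⁻; ⊆-antisym)
import Data.Integer as ℤ
import Data.Integer.Properties as ℤ
import Data.Integer.Tactic.RingSolver as ℤ-Solver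
open import Data.List using (List; []; _∷_; _++_; allFin; filter; length; map; cartesianProductWith)
import Data.List.Membership.Propositional as List
open import Data.List.Membership.Propositional.Properties.WithK using (unique∧set⇒bag)
open import Data.List.Membership.Propositional.Properties using (∈-allFin; ∈-filter⁺; ∈-filter⁻; ∈-map⁺; ∈-map⁻)
open import Data.List.Properties using (length-++; length-map; filter-++; filter-≐; map-cong)
open import Data.List.Relation.Binary.Permutation.Propositional.Properties using (↭-length)
open import Data.List.Relation.Binary.BagAndSetEquality using (∼bag⇒↭)
open import Data.List.Relation.Unary.Unique.Propositional using (Unique)
open import Data.List.Relation.Unary.Unique.Propositional.Properties using (allFin⁺; filter⁺; map⁺)
open import Data.Nat using (zero; suc; _≤_; z≤n; s≤s; _≤?_)
import Data.Nat.Properties as ℕ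
open import Data.Nat.ListAction using (sum)
import Data.Nat.Tactic.RingSolver as ℕ-Solver
open import Data.Product using (∃; _×_; _,_; proj₁; proj₂; map₂)
open import Data.Rational as Rational using (fromℚᵘ)
open import Data.Rational.Properties using (fromℚᵘ-cong; toℚᵘ-injective; toℚᵘ-fromℚᵘ; toℚᵘ-homo-+; toℚᵘ-homo-*; toℚᵘ-homo‿-)
open import Data.Rational.Unnormalised as ℚᵘ using (mkℚᵘ; *≡*)
import Data.Rational.Unnormalised.Properties as ℚᵘ
open import Data.Unit using (tt) renaming (⊤ to Unit)
open import Data.Vec as Vec using (Vec; []; _∷_; lookup; tabulate)
open import Data.Vec.Properties using (lookup-map; lookup∘tabulate; tabulate∘lookup; tabulate-cong; lookup⇒[]=; []=⇒lookup)
open import Function using (_∘_; _⇔_; mk⇔; Equivalence)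
open import Relation.Binary.PropositionalEquality using (refl; sym; trans; cong; cong₂; subst; module ≡-Reasoning)
open import Relation.Nullary using (Dec; does; yes; no; ¬_; ¬?; contradiction)
open import Relation.Nullary.Decidable using (_×-dec_; _→-dec_; from-yes; dec-true)
open import Relation.Unary using (Decidable)

private
  variable
    A : Set
    k l n : ℕ

-- Extensionality of vectors and deletion from subsets.

lookup-ext : {u v : Vec A n} → (∀ i → lookup u i ≡ lookup v i) → u ≡ v
lookup-ext {u = u} {v} eq = trans (sym (tabulate∘lookup u)) (trans (tabulate-cong eq) (tabulate∘lookup v))

x∉p-x : (p : Subset n) (x : Fin n) → x ∉ p ∖ x
x∉p-x (_ ∷ p) (fsuc x) (Vec.there x∈) = x∉p-x p x x∈

-- Subsequences of words

-- The bound `l` replaces passing to a suffix of `w`, so that matched positions stay in `Fin n` and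
-- serve directly as elements of the ground set.
OccursFrom : ℕ → List (Fin k) → Vec (Fin k) n → Set
OccursFrom l []      w = Unit
OccursFrom l (a ∷ p) w =
  ∃ λ x → l ≤ toℕ x × lookup w x ≡ a × OccursFrom (suc (toℕ x)) p w

occursFrom? : ∀ l (p : List (Fin k)) (w : Vec (Fin k) n) → Dec (OccursFrom l p w)
occursFrom? l []      w = yes tt
occursFrom? l (a ∷ p) w = any? λ x →
  (l ≤? toℕ x) ×-dec (lookup w x ≟ a) ×-dec occursFrom? (suc (toℕ x)) p w

occursFrom-∷⁺ : ∀ p {i : Fin k} {w : Vec (Fin k) n} →
                OccursFrom l p w → OccursFrom (suc l) p (i ∷ w)
occursFrom-∷⁺ []      _                   = tt
occursFrom-∷⁺ (a ∷ p) (x , l≤x , eq , oc) = fsuc x , s≤s l≤x , eq , occursFrom-∷⁺ p oc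

occursFrom-∷⁻ : ∀ p {i : Fin k} {w : Vec (Fin k) n} →
                OccursFrom (suc l) p (i ∷ w) → OccursFrom l p w
occursFrom-∷⁻ []      _                            = tt
occursFrom-∷⁻ (a ∷ p) (fsuc x , s≤s l≤x , eq , oc) = x , l≤x , eq , occursFrom-∷⁻ p oc

occursFrom-weaken : ∀ p {w : Vec (Fin k) n} → OccursFrom l p w → OccursFrom 0 p w
occursFrom-weaken []      _                 = tt
occursFrom-weaken (a ∷ p) (x , _ , eq , oc) = x , z≤n , eq , oc

occursFrom-tail : ∀ a p {w : Vec (Fin k) n} → OccursFrom l (a ∷ p) w → OccursFrom 0 p w
occursFrom-tail a p (x , _ , _ , oc) = occursFrom-weaken p oc

step : List (Fin k) → Fin k → List (Fin k)
step []      i = []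
step (a ∷ p) i = if does (i ≟ a) then p else a ∷ p

-- Greedy matching loses nothing: if `i` is `a` but the occurrence starts later, dropping its
-- initial `a` still leaves an occurrence of `p` in `w`. If `i` differs from `a`, the occurrence
-- cannot start at `i`.
occurs-step⁺ : ∀ p {i : Fin k} {w : Vec (Fin k) n} →
               OccursFrom 0 p (i ∷ w) → OccursFrom 0 (step p i) w
occurs-step⁺ []      _ = tt
occurs-step⁺ (a ∷ p) {i} oc with i ≟ a
occurs-step⁺ (a ∷ p) (fzero  , _ , _ , oc)   | yes _ = occursFrom-∷⁻ p oc
occurs-step⁺ (a ∷ p) (fsuc x , _ , eq , oc)  | yes _ =
  occursFrom-tail {l = 0} a p (x , z≤n , eq , occursFrom-∷⁻ p oc)
occurs-step⁺ (a ∷ p) (fzero  , _ , i≡a , _)  | no i≢a = contradiction i≡a i≢a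
occurs-step⁺ (a ∷ p) (fsuc x , _ , eq , oc)  | no _ = x , z≤n , eq , occursFrom-∷⁻ p oc

occurs-step⁻ : ∀ p {i : Fin k} {w : Vec (Fin k) n} →
               OccursFrom 0 (step p i) w → OccursFrom 0 p (i ∷ w)
occurs-step⁻ []      _ = tt
occurs-step⁻ (a ∷ p) {i} oc with i ≟ a
... | yes i≡a = fzero , z≤n , i≡a , occursFrom-∷⁺ p oc
... | no  _   = occursFrom-weaken (a ∷ p) (occursFrom-∷⁺ {l = 0} (a ∷ p) oc)

-- Letters outside `m` are unrestricted. For the full set this is surjectivity of the word, hence
-- nonemptiness of every block.
Uses : Subset k → Vec (Fin k) n → Set
Uses m w = ∀ i → i ∈ m → ∃ λ x → lookup w x ≡ i

uses? : (m : Subset k) (w : Vec (Fin k) n) → Dec (Uses m w)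
uses? m w = all? λ i → (i ∈? m) →-dec any? λ x → lookup w x ≟ i

uses-∷⁻ : ∀ m {i : Fin k} {w : Vec (Fin k) n} → Uses m (i ∷ w) → Uses (m ∖ i) w
uses-∷⁻ m {i} u j j∈ with u j (p─q⊆p m _ j∈)
... | fzero  , refl = contradiction j∈ (x∉p-x m i)
... | fsuc x , eq   = x , eq

uses-∷⁺ : ∀ m {i : Fin k} {w : Vec (Fin k) n} → Uses (m ∖ i) w → Uses m (i ∷ w)
uses-∷⁺ m {i} u j j∈ with j ≟ i
... | yes refl = fzero , refl
... | no  j≢i  = let x , eq = u j (x∈p∧x≢y⇒x∈p-y j∈ j≢i) in fsuc x , eq

Good : List (Fin k) → Subset k → Vec (Fin k) n → Set
Good p m w = ¬ OccursFrom 0 p w × Uses m w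

good? : (p : List (Fin k)) (m : Subset k) → Decidable (Good {n = n} p m)
good? p m w = ¬? (occursFrom? 0 p w) ×-dec uses? m w

-- Counting words

length-filter-map : {B : Set} {P : B → Set} (P? : Decidable P) (f : A → B) (xs : List A) →
                    length (filter P? (map f xs)) ≡ length (filter (P? ∘ f) xs)
length-filter-map P? f []       = refl
length-filter-map P? f (x ∷ xs) with does (P? (f x))
... | true  = cong suc (length-filter-map P? f xs)
... | false = length-filter-map P? f xs

length-filter-vectors : {P : Vec A (suc n) → Set} (P? : Decidable P) (xs : List A) (vs : List (Vec A n)) →
  length (filter P? (cartesianProductWith _∷_ xs vs)) ≡
  sum (map (λ x → length (filter (P? ∘ (x ∷_)) vs)) xs)
length-filter-vectors P? []       vs = refl
length-filter-vectors P? (x ∷ xs) vs = begin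
  length (filter P? (map (x ∷_) vs ++ rest))
    ≡⟨ cong length (filter-++ P? (map (x ∷_) vs) rest) ⟩
  length (filter P? (map (x ∷_) vs) ++ filter P? rest)
    ≡⟨ length-++ (filter P? (map (x ∷_) vs)) ⟩
  length (filter P? (map (x ∷_) vs)) ℕ.+ length (filter P? rest)
    ≡⟨ cong₂ ℕ._+_ (length-filter-map P? (x ∷_) vs) (length-filter-vectors P? xs vs) ⟩
  length (filter (P? ∘ (x ∷_)) vs) ℕ.+ sum (map (λ x → length (filter (P? ∘ (x ∷_)) vs)) xs) ∎
  where
  open ≡-Reasoning
  rest = cartesianProductWith _∷_ xs vs

-- The filtered `ys` and the `f`-image of the filtered `xs` are duplicate-free lists with the same
-- members, hence permutations of each other.
length-filter-bijection :
  {B : Set} {P : B → Set} {Q : A → Set} (P? : Decidable P) (Q? : Decidable Q)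
  {ys : List B} {xs : List A} {f : A → B} → Unique ys → Unique xs →
  (∀ y → y List.∈ ys) → (∀ x → x List.∈ xs) → (∀ {u v} → f u ≡ f v → u ≡ v) →
  (∀ {y} → P y → ∃ λ x → y ≡ f x × Q x) → (∀ {x} → Q x → P (f x)) →
  length (filter P? ys) ≡ length (filter Q? xs)
length-filter-bijection P? Q? {ys} {xs} {f} ys! xs! ys-all xs-all inj P⇒Q Q⇒P =
  trans (↭-length (∼bag⇒↭ (unique∧set⇒bag (filter⁺ P? ys!) (map⁺ inj (filter⁺ Q? xs!)) (mk⇔ to from))))
        (length-map f (filter Q? xs))
  where
  to : ∀ {y} → y List.∈ filter P? ys → y List.∈ map f (filter Q? xs)
  to y∈ with x , refl , qx ← P⇒Q (proj₂ (∈-filter⁻ P? {xs = ys} y∈)) =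
    ∈-map⁺ f (∈-filter⁺ Q? (xs-all x) qx)
  from : ∀ {y} → y List.∈ map f (filter Q? xs) → y List.∈ filter P? ys
  from y∈ with x , x∈ , refl ← ∈-map⁻ f y∈ =
    ∈-filter⁺ P? (ys-all (f x)) (Q⇒P (proj₂ (∈-filter⁻ Q? {xs = xs} x∈)))

words : ∀ k n → List (Vec (Fin k) n)
words k = vectors (allFin k)

-- Recursion on states makes the value at `suc n` unfold by computation to a sum over the successor
-- states. At length zero the empty word counts exactly when `p` is nonempty and `m` is empty.
count : List (Fin k) → Subset k → ℕ → ℕ
count p m zero        = length (filter (good? p m) ([] ∷ []))
count {k} p m (suc n) = sum (map (λ i → count (step p i) (m ∖ i) n) (allFin k))

length-filter-good : ∀ (p : List (Fin k)) m n → length (filter (good? p m) (words k n)) ≡ count p m n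
length-filter-good p m zero = refl
length-filter-good {k} p m (suc n) = trans
  (length-filter-vectors (good? p m) (allFin k) (words k n))
  (cong sum (map-cong (λ i → trans
    (cong length (filter-≐ (good? p m ∘ (i ∷_)) (good? (step p i) (m ∖ i))
      -- Avoidance is a negation, so each inclusion uses the occurrence lemma of the opposite
      -- direction.
      ( (λ (av , us) → av ∘ occurs-step⁻ p , uses-∷⁻ m us)
      , (λ (av , us) → av ∘ occurs-step⁺ p , uses-∷⁺ m us))
      (words k n)))
    (length-filter-good (step p i) (m ∖ i) n)) (allFin k)))

-- Ordered partitions as words

-- The fibres of `w` in the order of the letters. They are disjoint and cover the ground set for
-- every `w`; only nonemptiness constrains the word.
blocks : Vec (Fin k) n → Vec (Subset n) k
blocks w = tabulate λ i → Vec.map (λ j → does (j ≟ i)) w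

∈-blocks⁺ : (w : Vec (Fin k) n) {x : Fin n} {i : Fin k} → lookup w x ≡ i → x ∈ lookup (blocks w) i
∈-blocks⁺ w {x} {i} eq rewrite lookup∘tabulate (λ i → Vec.map (λ j → does (j ≟ i)) w) i =
  lookup⇒[]= x _ (trans (lookup-map x _ w) (dec-true (lookup w x ≟ i) eq))

∈-blocks⁻ : (w : Vec (Fin k) n) {x : Fin n} {i : Fin k} → x ∈ lookup (blocks w) i → lookup w x ≡ i
∈-blocks⁻ w {x} {i} x∈ rewrite lookup∘tabulate (λ i → Vec.map (λ j → does (j ≟ i)) w) i
  with lookup w x ≟ i | trans (sym (lookup-map x (λ j → does (j ≟ i)) w)) ([]=⇒lookup x∈)
... | yes eq | _ = eq

blocks-injective : {v w : Vec (Fin k) n} → blocks v ≡ blocks w → v ≡ w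
blocks-injective {v = v} {w} eq = lookup-ext λ x →
  sym (∈-blocks⁻ w (subst (λ B → x ∈ lookup B (lookup v x)) eq (∈-blocks⁺ v refl)))

blocks-isOrderedPartition : (w : Vec (Fin k) n) → Uses ⊤ w → IsOrderedPartition (blocks w)
blocks-isOrderedPartition w us = isOrderedPartition
  (λ i → map₂ (∈-blocks⁺ w) (us i ∈⊤))
  (λ i j i≢j (x , x∈) → let x∈i , x∈j = x∈p∩q⁻ _ _ x∈ in
    i≢j (trans (sym (∈-blocks⁻ w x∈i)) (∈-blocks⁻ w x∈j)))
  (λ x → lookup w x , ∈-blocks⁺ w refl)

-- Covering selects a block for each element, and disjointness makes that block the only one, so `B`
-- consists of the fibres of the selection.
blocks-surjective : (B : Vec (Subset n) k) → IsOrderedPartition B →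
                    ∃ λ w → B ≡ blocks w × Uses ⊤ w
blocks-surjective B (isOrderedPartition ne dj cv) = w , B≡ , λ i _ → map₂ unique (ne i)
  where
  w = tabulate (proj₁ ∘ cv)
  own : ∀ x → x ∈ lookup B (lookup w x)
  own x rewrite lookup∘tabulate (proj₁ ∘ cv) x = proj₂ (cv x)
  unique : ∀ {x i} → x ∈ lookup B i → lookup w x ≡ i
  unique {x} {i} x∈ with lookup w x ≟ i
  ... | yes eq = eq
  ... | no neq = contradiction (x , x∈p∩q⁺ (own x , x∈)) (dj (lookup w x) i neq)
  B≡ : B ≡ blocks w
  B≡ = lookup-ext λ i → ⊆-antisym
    (λ x∈ → ∈-blocks⁺ w (unique x∈))
    (λ {x} x∈ → subst (λ j → x ∈ lookup B j) (∈-blocks⁻ w x∈) (own x))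

word021 : List (Fin 3)
word021 = # 0 ∷ # 2 ∷ # 1 ∷ []

-- With exactly three blocks an occurrence of a pattern of length three meets all of them in order;
-- a finite check of all triples.
increasing-triple : ∀ (i j l : Fin 3) → i <ᶠ j → j <ᶠ l → i ≡ # 0 × j ≡ # 1 × l ≡ # 2
increasing-triple = from-yes triples?
  where
  triples? : Dec (∀ (i j l : Fin 3) → i <ᶠ j → j <ᶠ l → i ≡ # 0 × j ≡ # 1 × l ≡ # 2)
  triples? = all? λ i → all? λ j → all? λ l →
    (i <? j) →-dec ((j <? l) →-dec ((i ≟ # 0) ×-dec (j ≟ # 1) ×-dec (l ≟ # 2)))

contains⇒occurs : (w : Vec (Fin 3) n) → Contains (blocks w) pattern132 → OccursFrom 0 word021 w
contains⇒occurs w (i ∷ j ∷ l ∷ [] , inc , x ∷ y ∷ z ∷ [] , b∈ , iso)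
  with refl , refl , refl ← increasing-triple i j l (inc (# 0) (# 1) (s≤s z≤n)) (inc (# 1) (# 2) (s≤s (s≤s z≤n)))
  -- Positions are listed by increasing value: the pattern letters at indices 0, 2, 1 are 0, 1, 2,
  -- so the element `z` of the last block precedes `y`.
  = x , z≤n , ∈-blocks⁻ w (b∈ (# 0))
  , z , Equivalence.from (iso (# 0) (# 2)) (s≤s z≤n) , ∈-blocks⁻ w (b∈ (# 2))
  , y , Equivalence.from (iso (# 2) (# 1)) (s≤s (s≤s z≤n)) , ∈-blocks⁻ w (b∈ (# 1)) , tt

occurs⇒contains : (w : Vec (Fin 3) n) → OccursFrom 0 word021 w → Contains (blocks w) pattern132
occurs⇒contains w (x , _ , wx , z , x<z , wz , y , z<y , wy , tt) =
  # 0 ∷ # 1 ∷ # 2 ∷ [] , inc , bs , b∈ , iso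
  where
  bs = x ∷ y ∷ z ∷ []
  inc : StrictlyIncreasing (# 0 ∷ # 1 ∷ # 2 ∷ [])
  inc = from-yes (strictlyIncreasing? {3} (# 0 ∷ # 1 ∷ # 2 ∷ []))
  b∈ : ∀ j → lookup bs j ∈ lookup (blocks w) (lookup (# 0 ∷ # 1 ∷ # 2 ∷ []) j)
  b∈ fzero               = ∈-blocks⁺ w wx
  b∈ (fsuc fzero)        = ∈-blocks⁺ w wy
  b∈ (fsuc (fsuc fzero)) = ∈-blocks⁺ w wz
  both : ∀ {P Q : Set} → P → Q → P ⇔ Q
  both p q = mk⇔ (λ _ → q) (λ _ → p)
  neither : ∀ {P Q : Set} → ¬ P → ¬ Q → P ⇔ Q
  neither ¬p ¬q = mk⇔ (λ p → contradiction p ¬p) (λ q → contradiction q ¬q)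
  irr : ∀ {m} (i : Fin m) → ¬ i <ᶠ i
  irr i = <-irrefl {x = i} refl
  -- In each of the nine equivalences both sides hold or both fail, as decided by `x < z < y`.
  iso : OrderIsomorphic bs pattern132
  iso fzero               fzero               = neither (irr x) (irr {3} (# 0))
  iso fzero               (fsuc fzero)        = both (<-trans x<z z<y) (s≤s z≤n)
  iso fzero               (fsuc (fsuc fzero)) = both x<z (s≤s z≤n)
  iso (fsuc fzero)        fzero               = neither (<-asym (<-trans x<z z<y)) λ ()
  iso (fsuc fzero)        (fsuc fzero)        = neither (irr y) (irr {3} (# 2))
  iso (fsuc fzero)        (fsuc (fsuc fzero)) = neither (<-asym z<y) λ { (s≤s ()) }
  iso (fsuc (fsuc fzero)) fzero               = neither (<-asym x<z) λ ()
  iso (fsuc (fsuc fzero)) (fsuc fzero)        = both z<y (s≤s (s≤s z≤n))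
  iso (fsuc (fsuc fzero)) (fsuc (fsuc fzero)) = neither (irr z) (irr {3} (# 1))

op≡count : ∀ n → op n 3 pattern132 ≡ count word021 ⊤ n
op≡count n = trans (length-filter-bijection
  (λ B → isOrderedPartition? B ×-dec avoids? B pattern132) (good? word021 ⊤)
  (blockSequences-unique n 3) (vectors-unique (allFin⁺ 3) n)
  blockSequences-complete (vectors-complete ∈-allFin) blocks-injective
  (λ {B} (part , av) → good B av (blocks-surjective B part))
  (λ {w} (av , us) → blocks-isOrderedPartition w us , av ∘ contains⇒occurs w))
  (length-filter-good word021 ⊤ n)
  where
  good : ∀ B → Avoids B pattern132 → (∃ λ w → B ≡ blocks w × Uses ⊤ w) →
         ∃ λ w → B ≡ blocks w × Good word021 ⊤ w
  good B av (w , refl , us) = w , refl , av ∘ occurs⇒contains w , us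

-- Transfer of the formula from natural to rational numbers.

-- Normalisation respects the ring operations, so the formula can be checked on unreduced fractions,
-- where equality is an integer equation.
fromℚᵘ-formula : ∀ s t b p c →
  fromℚᵘ ((s ℚᵘ.+ t ℚᵘ.- b) ℚᵘ.* p ℚᵘ.+ c) ≡
  (fromℚᵘ s + fromℚᵘ t - fromℚᵘ b) * fromℚᵘ p + fromℚᵘ c
fromℚᵘ-formula s t b p c = toℚᵘ-injective (ℚᵘ.≃-trans
  (toℚᵘ-fromℚᵘ ((s ℚᵘ.+ t ℚᵘ.- b) ℚᵘ.* p ℚᵘ.+ c))
  (ℚᵘ.≃-sym
    (ℚᵘ.≃-trans (toℚᵘ-homo-+ ((s′ + t′ - b′) * p′) c′) (ℚᵘ.+-cong
      (ℚᵘ.≃-trans (toℚᵘ-homo-* (s′ + t′ - b′) p′) (ℚᵘ.*-cong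
        (ℚᵘ.≃-trans (toℚᵘ-homo-+ (s′ + t′) (Rational.- b′)) (ℚᵘ.+-cong
          (ℚᵘ.≃-trans (toℚᵘ-homo-+ s′ t′) (ℚᵘ.+-cong (toℚᵘ-fromℚᵘ s) (toℚᵘ-fromℚᵘ t)))
          (ℚᵘ.≃-trans (toℚᵘ-homo‿- b′) (ℚᵘ.-‿cong (toℚᵘ-fromℚᵘ b)))))
        (toℚᵘ-fromℚᵘ p)))
      (toℚᵘ-fromℚᵘ c)))))
  where
  s′ = fromℚᵘ s
  t′ = fromℚᵘ t
  b′ = fromℚᵘ b
  p′ = fromℚᵘ p
  c′ = fromℚᵘ c

-- Multiplying by 8 and moving the term with coefficient -2 to the left gives an equation without
-- division or subtraction, which can be proved in ℕ.
scaled-formula : ∀ a s t P → 8 ℕ.* a ℕ.+ 16 ℕ.* P ≡ (s ℕ.+ t) ℕ.* P ℕ.+ 24 →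
  + a / 1 ≡ (+ s / 8 + + t / 8 - + 2 / 1) * (+ P / 1) + + 3 / 1
scaled-formula a s t P eq = trans
  (fromℚᵘ-cong {mkℚᵘ (+ a) 0} {(mkℚᵘ (+ s) 7 ℚᵘ.+ mkℚᵘ (+ t) 7 ℚᵘ.- mkℚᵘ (+ 2) 0) ℚᵘ.* mkℚᵘ (+ P) 0 ℚᵘ.+ mkℚᵘ (+ 3) 0}
    (*≡* (cross-multiplied (+ a) (+ s) (+ t) (+ P) eqℤ)))
  (fromℚᵘ-formula (mkℚᵘ (+ s) 7) (mkℚᵘ (+ t) 7) (mkℚᵘ (+ 2) 0) (mkℚᵘ (+ P) 0) (mkℚᵘ (+ 3) 0))
  where
  eqℤ : + 8 ℤ.* + a ℤ.+ + 16 ℤ.* + P ≡ (+ s ℤ.+ + t) ℤ.* + P ℤ.+ + 24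
  eqℤ = trans (sym (cong₂ ℤ._+_ (ℤ.pos-* 8 a) (ℤ.pos-* 16 P)))
       (trans (cong +_ eq) (cong (ℤ._+ + 24) (ℤ.pos-* (s ℕ.+ t) P)))

  -- The conclusion is the cross-multiplication demanded by `*≡*`; 64 = 8 · 8 is the unreduced
  -- denominator of the sum of two eighths.
  cross-multiplied : ∀ a s t P → + 8 ℤ.* a ℤ.+ + 16 ℤ.* P ≡ (s ℤ.+ t) ℤ.* P ℤ.+ + 24 →
    a ℤ.* + 64 ≡
    (((s ℤ.* + 8 ℤ.+ t ℤ.* + 8) ℤ.* + 1 ℤ.+ (ℤ.- + 2) ℤ.* + 64) ℤ.* P ℤ.* + 1 ℤ.+ + 3 ℤ.* + 64) ℤ.* + 1
  -- Eight times the hypothesis, with 8 · 16 `P` = 128 `P` subtracted from both sides.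
  cross-multiplied a s t P eq = trans (lhs a P) (trans (cong (λ e → + 8 ℤ.* e ℤ.- + 128 ℤ.* P) eq) (rhs s t P))
    where
    lhs : ∀ a P → a ℤ.* + 64 ≡ + 8 ℤ.* (+ 8 ℤ.* a ℤ.+ + 16 ℤ.* P) ℤ.- + 128 ℤ.* P
    lhs = ℤ-Solver.solve-∀
    rhs : ∀ s t P → + 8 ℤ.* ((s ℤ.+ t) ℤ.* P ℤ.+ + 24) ℤ.- + 128 ℤ.* P ≡
      (((s ℤ.* + 8 ℤ.+ t ℤ.* + 8) ℤ.* + 1 ℤ.+ (ℤ.- + 2) ℤ.* + 64) ℤ.* P ℤ.* + 1 ℤ.+ + 3 ℤ.* + 64) ℤ.* + 1
    rhs = ℤ-Solver.solve-∀

-- Closed forms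

-- A dead state: the forbidden word has already been completed.
count-[] : ∀ m n → count {3} [] m n ≡ 0
count-[] m zero    = refl
count-[] m (suc n) rewrite count-[] (m ∖ # 0) n | count-[] (m ∖ # 1) n | count-[] (m ∖ # 2) n = refl

-- Each remaining letter is 0 or 2.
count-1-∅ : ∀ n → count {3} (# 1 ∷ []) ⊥ n ≡ 2 ℕ.^ n
count-1-∅ zero    = refl
count-1-∅ (suc n) rewrite count-[] ⊥ n | count-1-∅ n = refl

-- The letter 1 is both forbidden and still required.
count-1-1 : ∀ n → count {3} (# 1 ∷ []) ⁅ # 1 ⁆ n ≡ 0
count-1-1 zero    = refl
count-1-1 (suc n) rewrite count-[] ⊥ n | count-1-1 n = refl

-- In each closed form the recursion of count is regrouped into the left-hand
-- sides of the formulas for the successor states; all formulas are scaled and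
-- arranged so as to stay in ℕ.
word21 : List (Fin 3)
word21 = # 2 ∷ # 1 ∷ []

open ≡-Reasoning

-- Here and below `P` stands for `2 ^ n`, and the summands belong to the next letters 0, 1, 2 in
-- this order. Letters 0 and 1 keep the present state; letter 2 leaves 1 pending.
recurrence-21-∅ : ∀ x n P →
  2 ℕ.* x ≡ (n ℕ.+ 2) ℕ.* P →
  2 ℕ.* (x ℕ.+ (x ℕ.+ (P ℕ.+ 0))) ≡
  (suc n ℕ.+ 2) ℕ.* (2 ℕ.* P)
recurrence-21-∅ x n P hx = begin
  2 ℕ.* (x ℕ.+ (x ℕ.+ (P ℕ.+ 0)))
    ≡⟨ regroup x P ⟩
  2 ℕ.* (2 ℕ.* x) ℕ.+ 2 ℕ.* P
    ≡⟨ cong (λ a → 2 ℕ.* a ℕ.+ 2 ℕ.* P) hx ⟩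
  2 ℕ.* ((n ℕ.+ 2) ℕ.* P) ℕ.+ 2 ℕ.* P
    ≡⟨ simplify n P ⟩
  (suc n ℕ.+ 2) ℕ.* (2 ℕ.* P) ∎
  where
  regroup : ∀ x P →
    2 ℕ.* (x ℕ.+ (x ℕ.+ (P ℕ.+ 0))) ≡
    2 ℕ.* (2 ℕ.* x) ℕ.+ 2 ℕ.* P
  regroup = ℕ-Solver.solve-∀
  simplify : ∀ n P →
    2 ℕ.* ((n ℕ.+ 2) ℕ.* P) ℕ.+ 2 ℕ.* P ≡
    (suc n ℕ.+ 2) ℕ.* (2 ℕ.* P)
  simplify = ℕ-Solver.solve-∀

-- There are 2^n words without 2. Otherwise the first 2 has `n` possible positions, and each other
-- position has two choices: 0 or 1 before it, 0 or 2 after it.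
count-21-∅ : ∀ n → 2 ℕ.* count word21 ⊥ n ≡ (n ℕ.+ 2) ℕ.* 2 ℕ.^ n
count-21-∅ zero    = refl
count-21-∅ (suc n) rewrite count-1-∅ n =
  recurrence-21-∅ (count word21 ⊥ n) n (2 ℕ.^ n)
    (count-21-∅ n)

recurrence-21-2 : ∀ x n P →
  2 ℕ.* x ≡ n ℕ.* P →
  2 ℕ.* (x ℕ.+ (x ℕ.+ (P ℕ.+ 0))) ≡
  suc n ℕ.* (2 ℕ.* P)
recurrence-21-2 x n P hx = begin
  2 ℕ.* (x ℕ.+ (x ℕ.+ (P ℕ.+ 0)))
    ≡⟨ regroup x P ⟩
  2 ℕ.* (2 ℕ.* x) ℕ.+ 2 ℕ.* P
    ≡⟨ cong (λ a → 2 ℕ.* a ℕ.+ 2 ℕ.* P) hx ⟩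
  2 ℕ.* (n ℕ.* P) ℕ.+ 2 ℕ.* P
    ≡⟨ simplify n P ⟩
  suc n ℕ.* (2 ℕ.* P) ∎
  where
  regroup : ∀ x P →
    2 ℕ.* (x ℕ.+ (x ℕ.+ (P ℕ.+ 0))) ≡
    2 ℕ.* (2 ℕ.* x) ℕ.+ 2 ℕ.* P
  regroup = ℕ-Solver.solve-∀
  simplify : ∀ n P →
    2 ℕ.* (n ℕ.* P) ℕ.+ 2 ℕ.* P ≡
    suc n ℕ.* (2 ℕ.* P)
  simplify = ℕ-Solver.solve-∀

count-21-2 : ∀ n → 2 ℕ.* count word21 ⁅ # 2 ⁆ n ≡ n ℕ.* 2 ℕ.^ n
count-21-2 zero    = refl
count-21-2 (suc n) rewrite count-1-∅ n =
  recurrence-21-2 (count word21 ⁅ # 2 ⁆ n) n (2 ℕ.^ n)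
    (count-21-2 n)

recurrence-21-1 : ∀ x y n P →
  2 ℕ.* x ≡ n ℕ.* P →
  2 ℕ.* y ≡ (n ℕ.+ 2) ℕ.* P →
  2 ℕ.* (x ℕ.+ (y ℕ.+ (0 ℕ.+ 0))) ≡
  suc n ℕ.* (2 ℕ.* P)
recurrence-21-1 x y n P hx hy = begin
  2 ℕ.* (x ℕ.+ (y ℕ.+ (0 ℕ.+ 0)))
    ≡⟨ regroup x y P ⟩
  (2 ℕ.* x) ℕ.+ (2 ℕ.* y)
    ≡⟨ cong₂ (λ a b → a ℕ.+ b) hx hy ⟩
  (n ℕ.* P) ℕ.+ ((n ℕ.+ 2) ℕ.* P)
    ≡⟨ simplify n P ⟩
  suc n ℕ.* (2 ℕ.* P) ∎
  where
  regroup : ∀ x y P →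
    2 ℕ.* (x ℕ.+ (y ℕ.+ (0 ℕ.+ 0))) ≡
    (2 ℕ.* x) ℕ.+ (2 ℕ.* y)
  regroup = ℕ-Solver.solve-∀
  simplify : ∀ n P →
    (n ℕ.* P) ℕ.+ ((n ℕ.+ 2) ℕ.* P) ≡
    suc n ℕ.* (2 ℕ.* P)
  simplify = ℕ-Solver.solve-∀

-- Same value as in `count-21-2`, since reversing a word and exchanging 1 with 2 preserves avoidance
-- of 2, 1.
count-21-1 : ∀ n → 2 ℕ.* count word21 ⁅ # 1 ⁆ n ≡ n ℕ.* 2 ℕ.^ n
count-21-1 zero    = refl
count-21-1 (suc n) rewrite count-1-1 n =
  recurrence-21-1 (count word21 ⁅ # 1 ⁆ n) (count word21 ⊥ n) n (2 ℕ.^ n)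
    (count-21-1 n) (count-21-∅ n)

recurrence-21-12 : ∀ x y n P →
  2 ℕ.* x ℕ.+ 2 ℕ.* P ≡ n ℕ.* P ℕ.+ 2 →
  2 ℕ.* y ≡ n ℕ.* P →
  2 ℕ.* (x ℕ.+ (y ℕ.+ (0 ℕ.+ 0))) ℕ.+ 2 ℕ.* (2 ℕ.* P) ≡
  suc n ℕ.* (2 ℕ.* P) ℕ.+ 2
recurrence-21-12 x y n P hx hy = begin
  2 ℕ.* (x ℕ.+ (y ℕ.+ (0 ℕ.+ 0))) ℕ.+ 2 ℕ.* (2 ℕ.* P)
    ≡⟨ regroup x y P ⟩
  (2 ℕ.* x ℕ.+ 2 ℕ.* P) ℕ.+ (2 ℕ.* y) ℕ.+ 2 ℕ.* P
    ≡⟨ cong₂ (λ a b → a ℕ.+ b ℕ.+ 2 ℕ.* P) hx hy ⟩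
  (n ℕ.* P ℕ.+ 2) ℕ.+ (n ℕ.* P) ℕ.+ 2 ℕ.* P
    ≡⟨ simplify n P ⟩
  suc n ℕ.* (2 ℕ.* P) ℕ.+ 2 ∎
  where
  regroup : ∀ x y P →
    2 ℕ.* (x ℕ.+ (y ℕ.+ (0 ℕ.+ 0))) ℕ.+ 2 ℕ.* (2 ℕ.* P) ≡
    (2 ℕ.* x ℕ.+ 2 ℕ.* P) ℕ.+ (2 ℕ.* y) ℕ.+ 2 ℕ.* P
  regroup = ℕ-Solver.solve-∀
  simplify : ∀ n P →
    (n ℕ.* P ℕ.+ 2) ℕ.+ (n ℕ.* P) ℕ.+ 2 ℕ.* P ≡
    suc n ℕ.* (2 ℕ.* P) ℕ.+ 2
  simplify = ℕ-Solver.solve-∀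

-- Inclusion-exclusion: from all words avoiding 2, 1 remove the 2^n without 1 and the 2^n without 2,
-- and restore the word of zeros.
count-21-12 : ∀ n → 2 ℕ.* count word21 (⁅ # 1 ⁆ ∪ ⁅ # 2 ⁆) n ℕ.+ 2 ℕ.* 2 ℕ.^ n ≡ n ℕ.* 2 ℕ.^ n ℕ.+ 2
count-21-12 zero    = refl
count-21-12 (suc n) rewrite count-1-1 n =
  recurrence-21-12 (count word21 (⁅ # 1 ⁆ ∪ ⁅ # 2 ⁆) n) (count word21 ⁅ # 2 ⁆ n) n (2 ℕ.^ n)
    (count-21-12 n) (count-21-2 n)

recurrence-021-0 : ∀ x y n P →
  2 ℕ.* x ≡ (n ℕ.+ 2) ℕ.* P →
  8 ℕ.* y ≡ (n ℕ.* n ℕ.+ 3 ℕ.* n) ℕ.* P →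
  8 ℕ.* (x ℕ.+ (y ℕ.+ (y ℕ.+ 0))) ≡
  (suc n ℕ.* suc n ℕ.+ 3 ℕ.* suc n) ℕ.* (2 ℕ.* P)
recurrence-021-0 x y n P hx hy = begin
  8 ℕ.* (x ℕ.+ (y ℕ.+ (y ℕ.+ 0)))
    ≡⟨ regroup x y P ⟩
  4 ℕ.* (2 ℕ.* x) ℕ.+ 2 ℕ.* (8 ℕ.* y)
    ≡⟨ cong₂ (λ a b → 4 ℕ.* a ℕ.+ 2 ℕ.* b) hx hy ⟩
  4 ℕ.* ((n ℕ.+ 2) ℕ.* P) ℕ.+ 2 ℕ.* ((n ℕ.* n ℕ.+ 3 ℕ.* n) ℕ.* P)
    ≡⟨ simplify n P ⟩
  (suc n ℕ.* suc n ℕ.+ 3 ℕ.* suc n) ℕ.* (2 ℕ.* P) ∎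
  where
  regroup : ∀ x y P →
    8 ℕ.* (x ℕ.+ (y ℕ.+ (y ℕ.+ 0))) ≡
    4 ℕ.* (2 ℕ.* x) ℕ.+ 2 ℕ.* (8 ℕ.* y)
  regroup = ℕ-Solver.solve-∀
  simplify : ∀ n P →
    4 ℕ.* ((n ℕ.+ 2) ℕ.* P) ℕ.+ 2 ℕ.* ((n ℕ.* n ℕ.+ 3 ℕ.* n) ℕ.* P) ≡
    (suc n ℕ.* suc n ℕ.+ 3 ℕ.* suc n) ℕ.* (2 ℕ.* P)
  simplify = ℕ-Solver.solve-∀

-- Before the first 0 each letter is 1 or 2; after it the word avoids 2, 1. Summing `count-21-∅`
-- over the position of that 0 produces the quadratic factor.
count-021-0 : ∀ n → 8 ℕ.* count word021 ⁅ # 0 ⁆ n ≡ (n ℕ.* n ℕ.+ 3 ℕ.* n) ℕ.* 2 ℕ.^ n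
count-021-0 zero    = refl
count-021-0 (suc n) =
  recurrence-021-0 (count word21 ⊥ n) (count word021 ⁅ # 0 ⁆ n) n (2 ℕ.^ n)
    (count-21-∅ n) (count-021-0 n)

recurrence-021-02 : ∀ x y z n P →
  2 ℕ.* x ≡ n ℕ.* P →
  8 ℕ.* y ℕ.+ 8 ℕ.* P ≡ (n ℕ.* n ℕ.+ 3 ℕ.* n) ℕ.* P ℕ.+ 8 →
  8 ℕ.* z ≡ (n ℕ.* n ℕ.+ 3 ℕ.* n) ℕ.* P →
  8 ℕ.* (x ℕ.+ (y ℕ.+ (z ℕ.+ 0))) ℕ.+ 8 ℕ.* (2 ℕ.* P) ≡
  (suc n ℕ.* suc n ℕ.+ 3 ℕ.* suc n) ℕ.* (2 ℕ.* P) ℕ.+ 8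
recurrence-021-02 x y z n P hx hy hz = begin
  8 ℕ.* (x ℕ.+ (y ℕ.+ (z ℕ.+ 0))) ℕ.+ 8 ℕ.* (2 ℕ.* P)
    ≡⟨ regroup x y z P ⟩
  4 ℕ.* (2 ℕ.* x) ℕ.+ (8 ℕ.* y ℕ.+ 8 ℕ.* P) ℕ.+ (8 ℕ.* z) ℕ.+ 8 ℕ.* P
    ≡⟨ cong₂ (λ a b → 4 ℕ.* a ℕ.+ b ℕ.+ (8 ℕ.* z) ℕ.+ 8 ℕ.* P) hx hy ⟩
  4 ℕ.* (n ℕ.* P) ℕ.+ ((n ℕ.* n ℕ.+ 3 ℕ.* n) ℕ.* P ℕ.+ 8) ℕ.+ (8 ℕ.* z) ℕ.+ 8 ℕ.* P
    ≡⟨ cong (λ a → 4 ℕ.* (n ℕ.* P) ℕ.+ ((n ℕ.* n ℕ.+ 3 ℕ.* n) ℕ.* P ℕ.+ 8) ℕ.+ a ℕ.+ 8 ℕ.* P) hz ⟩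
  4 ℕ.* (n ℕ.* P) ℕ.+ ((n ℕ.* n ℕ.+ 3 ℕ.* n) ℕ.* P ℕ.+ 8) ℕ.+ ((n ℕ.* n ℕ.+ 3 ℕ.* n) ℕ.* P) ℕ.+ 8 ℕ.* P
    ≡⟨ simplify n P ⟩
  (suc n ℕ.* suc n ℕ.+ 3 ℕ.* suc n) ℕ.* (2 ℕ.* P) ℕ.+ 8 ∎
  where
  regroup : ∀ x y z P →
    8 ℕ.* (x ℕ.+ (y ℕ.+ (z ℕ.+ 0))) ℕ.+ 8 ℕ.* (2 ℕ.* P) ≡
    4 ℕ.* (2 ℕ.* x) ℕ.+ (8 ℕ.* y ℕ.+ 8 ℕ.* P) ℕ.+ (8 ℕ.* z) ℕ.+ 8 ℕ.* P
  regroup = ℕ-Solver.solve-∀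
  simplify : ∀ n P →
    4 ℕ.* (n ℕ.* P) ℕ.+ ((n ℕ.* n ℕ.+ 3 ℕ.* n) ℕ.* P ℕ.+ 8) ℕ.+ ((n ℕ.* n ℕ.+ 3 ℕ.* n) ℕ.* P) ℕ.+ 8 ℕ.* P ≡
    (suc n ℕ.* suc n ℕ.+ 3 ℕ.* suc n) ℕ.* (2 ℕ.* P) ℕ.+ 8
  simplify = ℕ-Solver.solve-∀

-- Compared with `count-021-0`, the 2^n - 1 words over 0 and 1 that contain a 0 are lost.
count-021-02 : ∀ n → 8 ℕ.* count word021 (⁅ # 0 ⁆ ∪ ⁅ # 2 ⁆) n ℕ.+ 8 ℕ.* 2 ℕ.^ n ≡ (n ℕ.* n ℕ.+ 3 ℕ.* n) ℕ.* 2 ℕ.^ n ℕ.+ 8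
count-021-02 zero    = refl
count-021-02 (suc n) =
  recurrence-021-02 (count word21 ⁅ # 2 ⁆ n) (count word021 (⁅ # 0 ⁆ ∪ ⁅ # 2 ⁆) n) (count word021 ⁅ # 0 ⁆ n) n (2 ℕ.^ n)
    (count-21-2 n) (count-021-02 n) (count-021-0 n)

recurrence-021-01 : ∀ x y z n P →
  2 ℕ.* x ≡ n ℕ.* P →
  8 ℕ.* y ≡ (n ℕ.* n ℕ.+ 3 ℕ.* n) ℕ.* P →
  8 ℕ.* z ℕ.+ 8 ℕ.* P ≡ (n ℕ.* n ℕ.+ 3 ℕ.* n) ℕ.* P ℕ.+ 8 →
  8 ℕ.* (x ℕ.+ (y ℕ.+ (z ℕ.+ 0))) ℕ.+ 8 ℕ.* (2 ℕ.* P) ≡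
  (suc n ℕ.* suc n ℕ.+ 3 ℕ.* suc n) ℕ.* (2 ℕ.* P) ℕ.+ 8
recurrence-021-01 x y z n P hx hy hz = begin
  8 ℕ.* (x ℕ.+ (y ℕ.+ (z ℕ.+ 0))) ℕ.+ 8 ℕ.* (2 ℕ.* P)
    ≡⟨ regroup x y z P ⟩
  4 ℕ.* (2 ℕ.* x) ℕ.+ (8 ℕ.* y) ℕ.+ (8 ℕ.* z ℕ.+ 8 ℕ.* P) ℕ.+ 8 ℕ.* P
    ≡⟨ cong₂ (λ a b → 4 ℕ.* a ℕ.+ b ℕ.+ (8 ℕ.* z ℕ.+ 8 ℕ.* P) ℕ.+ 8 ℕ.* P) hx hy ⟩
  4 ℕ.* (n ℕ.* P) ℕ.+ ((n ℕ.* n ℕ.+ 3 ℕ.* n) ℕ.* P) ℕ.+ (8 ℕ.* z ℕ.+ 8 ℕ.* P) ℕ.+ 8 ℕ.* P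
    ≡⟨ cong (λ a → 4 ℕ.* (n ℕ.* P) ℕ.+ ((n ℕ.* n ℕ.+ 3 ℕ.* n) ℕ.* P) ℕ.+ a ℕ.+ 8 ℕ.* P) hz ⟩
  4 ℕ.* (n ℕ.* P) ℕ.+ ((n ℕ.* n ℕ.+ 3 ℕ.* n) ℕ.* P) ℕ.+ ((n ℕ.* n ℕ.+ 3 ℕ.* n) ℕ.* P ℕ.+ 8) ℕ.+ 8 ℕ.* P
    ≡⟨ simplify n P ⟩
  (suc n ℕ.* suc n ℕ.+ 3 ℕ.* suc n) ℕ.* (2 ℕ.* P) ℕ.+ 8 ∎
  where
  regroup : ∀ x y z P →
    8 ℕ.* (x ℕ.+ (y ℕ.+ (z ℕ.+ 0))) ℕ.+ 8 ℕ.* (2 ℕ.* P) ≡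
    4 ℕ.* (2 ℕ.* x) ℕ.+ (8 ℕ.* y) ℕ.+ (8 ℕ.* z ℕ.+ 8 ℕ.* P) ℕ.+ 8 ℕ.* P
  regroup = ℕ-Solver.solve-∀
  simplify : ∀ n P →
    4 ℕ.* (n ℕ.* P) ℕ.+ ((n ℕ.* n ℕ.+ 3 ℕ.* n) ℕ.* P) ℕ.+ ((n ℕ.* n ℕ.+ 3 ℕ.* n) ℕ.* P ℕ.+ 8) ℕ.+ 8 ℕ.* P ≡
    (suc n ℕ.* suc n ℕ.+ 3 ℕ.* suc n) ℕ.* (2 ℕ.* P) ℕ.+ 8
  simplify = ℕ-Solver.solve-∀

-- Likewise the 2^n - 1 words over 0 and 2 that contain a 0 are lost.
count-021-01 : ∀ n → 8 ℕ.* count word021 (⁅ # 0 ⁆ ∪ ⁅ # 1 ⁆) n ℕ.+ 8 ℕ.* 2 ℕ.^ n ≡ (n ℕ.* n ℕ.+ 3 ℕ.* n) ℕ.* 2 ℕ.^ n ℕ.+ 8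
count-021-01 zero    = refl
count-021-01 (suc n) =
  recurrence-021-01 (count word21 ⁅ # 1 ⁆ n) (count word021 ⁅ # 0 ⁆ n) (count word021 (⁅ # 0 ⁆ ∪ ⁅ # 1 ⁆) n) n (2 ℕ.^ n)
    (count-21-1 n) (count-021-0 n) (count-021-01 n)

recurrence-021-012 : ∀ x y z n P →
  2 ℕ.* x ℕ.+ 2 ℕ.* P ≡ n ℕ.* P ℕ.+ 2 →
  8 ℕ.* y ℕ.+ 8 ℕ.* P ≡ (n ℕ.* n ℕ.+ 3 ℕ.* n) ℕ.* P ℕ.+ 8 →
  8 ℕ.* z ℕ.+ 8 ℕ.* P ≡ (n ℕ.* n ℕ.+ 3 ℕ.* n) ℕ.* P ℕ.+ 8 →
  8 ℕ.* (x ℕ.+ (y ℕ.+ (z ℕ.+ 0))) ℕ.+ 16 ℕ.* (2 ℕ.* P) ≡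
  (suc n ℕ.* suc n ℕ.+ 3 ℕ.* suc n) ℕ.* (2 ℕ.* P) ℕ.+ 24
recurrence-021-012 x y z n P hx hy hz = begin
  8 ℕ.* (x ℕ.+ (y ℕ.+ (z ℕ.+ 0))) ℕ.+ 16 ℕ.* (2 ℕ.* P)
    ≡⟨ regroup x y z P ⟩
  4 ℕ.* (2 ℕ.* x ℕ.+ 2 ℕ.* P) ℕ.+ (8 ℕ.* y ℕ.+ 8 ℕ.* P) ℕ.+ (8 ℕ.* z ℕ.+ 8 ℕ.* P) ℕ.+ 8 ℕ.* P
    ≡⟨ cong₂ (λ a b → 4 ℕ.* a ℕ.+ b ℕ.+ (8 ℕ.* z ℕ.+ 8 ℕ.* P) ℕ.+ 8 ℕ.* P) hx hy ⟩
  4 ℕ.* (n ℕ.* P ℕ.+ 2) ℕ.+ ((n ℕ.* n ℕ.+ 3 ℕ.* n) ℕ.* P ℕ.+ 8) ℕ.+ (8 ℕ.* z ℕ.+ 8 ℕ.* P) ℕ.+ 8 ℕ.* P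
    ≡⟨ cong (λ a → 4 ℕ.* (n ℕ.* P ℕ.+ 2) ℕ.+ ((n ℕ.* n ℕ.+ 3 ℕ.* n) ℕ.* P ℕ.+ 8) ℕ.+ a ℕ.+ 8 ℕ.* P) hz ⟩
  4 ℕ.* (n ℕ.* P ℕ.+ 2) ℕ.+ ((n ℕ.* n ℕ.+ 3 ℕ.* n) ℕ.* P ℕ.+ 8) ℕ.+ ((n ℕ.* n ℕ.+ 3 ℕ.* n) ℕ.* P ℕ.+ 8) ℕ.+ 8 ℕ.* P
    ≡⟨ simplify n P ⟩
  (suc n ℕ.* suc n ℕ.+ 3 ℕ.* suc n) ℕ.* (2 ℕ.* P) ℕ.+ 24 ∎
  where
  regroup : ∀ x y z P →
    8 ℕ.* (x ℕ.+ (y ℕ.+ (z ℕ.+ 0))) ℕ.+ 16 ℕ.* (2 ℕ.* P) ≡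
    4 ℕ.* (2 ℕ.* x ℕ.+ 2 ℕ.* P) ℕ.+ (8 ℕ.* y ℕ.+ 8 ℕ.* P) ℕ.+ (8 ℕ.* z ℕ.+ 8 ℕ.* P) ℕ.+ 8 ℕ.* P
  regroup = ℕ-Solver.solve-∀
  simplify : ∀ n P →
    4 ℕ.* (n ℕ.* P ℕ.+ 2) ℕ.+ ((n ℕ.* n ℕ.+ 3 ℕ.* n) ℕ.* P ℕ.+ 8) ℕ.+ ((n ℕ.* n ℕ.+ 3 ℕ.* n) ℕ.* P ℕ.+ 8) ℕ.+ 8 ℕ.* P ≡
    (suc n ℕ.* suc n ℕ.+ 3 ℕ.* suc n) ℕ.* (2 ℕ.* P) ℕ.+ 24
  simplify = ℕ-Solver.solve-∀

-- Every first letter leaves the full set, so no induction occurs. The length is `suc n` because at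
-- length zero the sides would be 16 and 24.
count-021-012 : ∀ n → 8 ℕ.* count word021 ⊤ (suc n) ℕ.+ 16 ℕ.* 2 ℕ.^ suc n ≡
  (suc n ℕ.* suc n ℕ.+ 3 ℕ.* suc n) ℕ.* 2 ℕ.^ suc n ℕ.+ 24
count-021-012 n =
  recurrence-021-012 (count word21 (⁅ # 1 ⁆ ∪ ⁅ # 2 ⁆) n) (count word021 (⁅ # 0 ⁆ ∪ ⁅ # 2 ⁆) n) (count word021 (⁅ # 0 ⁆ ∪ ⁅ # 1 ⁆) n) n (2 ℕ.^ n)
    (count-21-12 n) (count-021-02 n) (count-021-01 n)

theorem3 : (n : ℕ) → n ℕ.≥ 1 →
    + (op n 3 pattern132) / 1 ≡ (+ (n ℕ.^ 2) / 8 + + (3 ℕ.* n) / 8 - + 2 / 1) * (+ (2 ℕ.^ n) / 1) + + 3 / 1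
theorem3 n@(suc n-1) _ = scaled-formula (op n 3 pattern132) (n ℕ.^ 2) (3 ℕ.* n) (2 ℕ.^ n) (begin
  8 ℕ.* op n 3 pattern132 ℕ.+ 16 ℕ.* 2 ℕ.^ n
    ≡⟨ cong (λ c → 8 ℕ.* c ℕ.+ 16 ℕ.* 2 ℕ.^ n) (op≡count n) ⟩
  8 ℕ.* count word021 ⊤ n ℕ.+ 16 ℕ.* 2 ℕ.^ n
    ≡⟨ count-021-012 n-1 ⟩
  (n ℕ.* n ℕ.+ 3 ℕ.* n) ℕ.* 2 ℕ.^ n ℕ.+ 24
    -- `n ^ 2` unfolds to `n * (n * 1)`.
    ≡⟨ cong (λ s → (n ℕ.* s ℕ.+ 3 ℕ.* n) ℕ.* 2 ℕ.^ n ℕ.+ 24) (ℕ.*-identityʳ n) ⟨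
  (n ℕ.^ 2 ℕ.+ 3 ℕ.* n) ℕ.* 2 ℕ.^ n ℕ.+ 24 ∎)
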